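{- Let $G$ and $H$ be finite graphs and let $R\subseteq V_G\times V_H$ be a relation with $G\ast R=H$. Then there exist a set $B$, an injective relation $R_D\subseteq \operatorname{dom}R\times B$ with full domain, and a functional relation $R_C\subseteq B\times\operatorname{img}R$ with full image such that $(G[\operatorname{dom}R]\ast R_D)\ast R_C=H$.
   Context: Graphs are finite and undirected, loops allowed; a graph is $G=(V_G,E_G)$ with $E_G\subseteq V_G\times V_G$ symmetric. $G[W]$ is the subgraph of $G$ induced by $W\subseteq V_G$. For a finite set $B$ and a relation $R\subseteq V_G\times B$ with full image (every $b\in B$ has some $v\in V_G$ with $(v,b)\in R$), $G\ast R$ is the graph with vertex set $B$ and edge set $\{(a,b)\in B\times B: \exists (u,v)\in E_G,\ (u,a)\in R,\ (v,b)\in R\}$; writing $G\ast R$ presupposes that $R$ has full image. For $R\subseteq X\times Y$: $\operatorname{dom}R=\{x:\exists y,(x,y)\in R\}$, $\operatorname{img}R=\{y:\exists x,(x,y)\in R\}$; $R$ has full domain if $\operatorname{dom}R=X$ and full image if $\operatorname{img}R=Y$; $R$ is injective if $(x,y),(z,y)\in R$ implies $x=z$; $R$ is functional if $(x,y),(x,z)\in R$ implies $y=z$. -}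

module Defs where

open import Data.List.Base using (List; filter)
open import Data.List.Membership.Propositional using (find; lose)
  renaming (_∈_ to _∈ₗ_)
open import Data.List.Membership.Propositional.Properties
  using (∈-filter⁺; ∈-filter⁻)
open import Data.List.Relation.Unary.Any using (any?)
open import Data.List.Relation.Unary.Unique.Propositional using (Unique)
open import Data.List.Relation.Unary.Unique.Propositional.Properties
  using () renaming (filter⁺ to unique-filter)
open import Data.Product.Base using (Σ; ∃; ∃₂; _×_; _,_; proj₁; proj₂)
open import Level using (0ℓ)
open import Relation.Binary.Core using (Rel; REL; _⇔_)
open import Relation.Binary.Definitions using (Symmetric)
  renaming (Decidable to Decidable₂)
open import Relation.Binary.PropositionalEquality.Core using (_≡_)
open import Relation.Binary.Rewriting using (Deterministic)
open import Relation.Nullary.Decidable.Core using (Dec; map′; _×-dec_)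
open import Relation.Unary using (Pred; _∈_; _⊆_; _≐_; Decidable)

-- Sets are predicates on an ambient type, so that "img R = V_H" or an
-- equality of graphs is extensional equality of sets.  Subsets of finite
-- sets are finite classically; here this needs membership and all relations
-- to be decidable.

record FinSet (A : Set) : Set₁ where
  field
    member   : Pred A 0ℓ
    member?  : Decidable member
    elements : List A
    unique   : Unique elements
    complete : ∀ {x} → x ∈ member → x ∈ₗ elements
    sound    : ∀ {x} → x ∈ₗ elements → x ∈ member

open FinSet public using (member; member?)

separate : {A : Set} (S : FinSet A) {P : Pred A 0ℓ} →
           Decidable P → P ⊆ member S → FinSet A
separate S {P} P? P⊆S = record
  { member   = P
  ; member?  = P?
  ; elements = filter P? elements
  ; unique   = unique-filter P? unique
  ; complete = λ p → ∈-filter⁺ P? (complete (P⊆S p)) p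
  ; sound    = λ i → proj₂ (∈-filter⁻ P? {xs = elements} i)
  }
  where open FinSet S using (elements; unique; complete)

∃? : {A : Set} (S : FinSet A) {P : Pred A 0ℓ} →
     Decidable P → P ⊆ member S → Dec (∃ P)
∃? S P? P⊆S = map′
  (λ a → let x , _ , p = find a in x , p)
  (λ (_ , p) → lose (complete (P⊆S p)) p)
  (any? P? elements)
  where open FinSet S using (elements; complete)

record Relation {A C : Set} (X : FinSet A) (Y : FinSet C) : Set₁ where
  field
    rel    : REL A C 0ℓ
    rel?   : Decidable₂ rel
    within : ∀ {x y} → rel x y → x ∈ member X × y ∈ member Y

open Relation public using (rel; rel?; within)

module _ {A C : Set} {X : FinSet A} {Y : FinSet C} (R : Relation X Y) where

  Dom : Pred A 0ℓ
  Dom x = ∃ λ y → rel R x y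

  Img : Pred C 0ℓ
  Img y = ∃ λ x → rel R x y

  Dom⊆ : Dom ⊆ member X
  Dom⊆ (_ , r) = proj₁ (within R r)

  Img⊆ : Img ⊆ member Y
  Img⊆ (_ , r) = proj₂ (within R r)

  dom : FinSet A
  dom = separate X (λ x → ∃? Y (rel? R x) (λ r → proj₂ (within R r))) Dom⊆

  img : FinSet C
  img = separate Y
    (λ y → ∃? X (λ x → rel? R x y) (λ r → proj₁ (within R r))) Img⊆

  FullDomain : Set
  FullDomain = member dom ≐ member X

  FullImage : Set
  FullImage = member img ≐ member Y

  Injective : Set
  Injective = ∀ {x y z} → rel R x y → rel R z y → x ≡ z

  Functional : Set
  Functional = Deterministic _≡_ (rel R)

record Graph (A : Set) : Set₁ where
  field
    V    : FinSet A
    E    : Rel A 0ℓ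
    E?   : Decidable₂ E
    E⊆V² : ∀ {u v} → E u v → u ∈ member V × v ∈ member V
    symm : Symmetric E

open Graph public using (V; E; E?; E⊆V²; symm)

infix 4 _≈_

_≈_ : {A : Set} → Graph A → Graph A → Set
G ≈ H = (member (V G) ≐ member (V H)) × (E G ⇔ E H)

infix 8 _[_∣_]

_[_∣_] : {A : Set} (G : Graph A) (W : FinSet A) →
         member W ⊆ member (V G) → Graph A
G [ W ∣ _ ] = record
  { V    = W
  ; E    = λ u v → E G u v × u ∈ member W × v ∈ member W
  ; E?   = λ u v → E? G u v ×-dec (member? W u ×-dec member? W v)
  ; E⊆V² = proj₂
  ; symm = λ (e , u∈W , v∈W) → symm G e , v∈W , u∈W
  }

infix 7 _∗_⟨_⟩

_∗_⟨_⟩ : {A C : Set} (G : Graph A) {B : FinSet C} (R : Relation (V G) B) →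
         FullImage R → Graph C
_∗_⟨_⟩ G {B} R _ = record
  { V    = B
  ; E    = λ a b → ∃₂ λ u v → E G u v × rel R u a × rel R v b
  ; E?   = λ a b →
      ∃? (V G)
        (λ u → ∃? (V G)
          (λ v → E? G u v ×-dec (rel? R u a ×-dec rel? R v b))
          (λ (e , _) → proj₂ (E⊆V² G e)))
        (λ (_ , e , _) → proj₁ (E⊆V² G e))
  ; E⊆V² = λ (_ , _ , _ , r , s) → proj₂ (within R r) , proj₂ (within R s)
  ; symm = λ (u , v , e , r , s) → v , u , symm G e , s , r
  }

{-# OPTIONS --safe #-}
-- Take B = R, the set of pairs (x , y) with x R y; relate x to (x , y) in R-D
-- and (x , y) to y in R-C.  The composite of R-D and R-C is R.
module Submission where

open import Defs
open import Data.List.Base using (List; cartesianProduct)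
open import Data.List.Membership.Propositional.Properties
  using (∈-cartesianProduct⁺; ∈-cartesianProduct⁻)
open import Data.List.Membership.Propositional renaming (_∈_ to _∈ₗ_)
open import Data.List.Relation.Unary.All using () renaming (lookup to All-lookup)
open import Data.List.Relation.Unary.AllPairs using (_∷_)
open import Data.List.Relation.Unary.Any using (here; there)
open import Data.List.Relation.Unary.Unique.Propositional using (Unique)
open import Data.List.Relation.Unary.Unique.Propositional.Properties
  using (cartesianProduct⁺)
open import Data.Product using (Σ-syntax; _×_; _,_; proj₁; proj₂; uncurry)
open import Function.Base using (_∘_)
open import Relation.Binary.PropositionalEquality using (_≡_; refl; sym; trans)
open import Relation.Nullary.Decidable using (Dec; yes; no; _×-dec_)
open import Relation.Unary using (_∈_)

-- Every relation factors through its own graph: `R` is the converse of the first projection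
-- followed by the second projection. Both projections are functions, so the first factor is
-- injective and the second functional. Applying the factors in turn joins `a` to `b` exactly when
-- some edge `(u , v)` has `u` related to `a` and `v` to `b`; such endpoints lie in `dom R`, so
-- restricting `G` loses no edge. The remaining work is decidability of the two factors.

-- Membership proofs are positions, and in a duplicate-free list two entries agree exactly when
-- their positions do.
unique⇒≟ : {A : Set} {xs : List A} {x y : A} →
           Unique xs → x ∈ₗ xs → y ∈ₗ xs → Dec (x ≡ y)
unique⇒≟ _        (here refl) (here refl) = yes refl
unique⇒≟ (z∉ ∷ _) (here refl) (there j)   = no (All-lookup z∉ j)
unique⇒≟ (z∉ ∷ _) (there i)   (here refl) = no (All-lookup z∉ i ∘ sym)
unique⇒≟ (_ ∷ u)  (there i)   (there j)   = unique⇒≟ u i j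

-- The ambient type need not have decidable equality: x is compared with a
-- member y only after testing whether x is a member itself.
≡-member? : {A : Set} (S : FinSet A) (x : A) {y : A} →
            y ∈ member S → Dec (x ≡ y)
≡-member? S x y∈S with member? S x
... | yes x∈S = unique⇒≟ unique (complete x∈S) (complete y∈S)
  where open FinSet S using (unique; complete)
... | no  x∉S = no λ { refl → x∉S y∈S }

_×-finSet_ : {A C : Set} → FinSet A → FinSet C → FinSet (A × C)
S ×-finSet T = record
  { member   = λ (x , y) → x ∈ member S × y ∈ member T
  ; member?  = λ (x , y) → member? S x ×-dec member? T y
  ; elements = cartesianProduct S.elements T.elements
  ; unique   = cartesianProduct⁺ S.unique T.unique
  ; complete = λ (x∈S , y∈T) →
      ∈-cartesianProduct⁺ (S.complete x∈S) (T.complete y∈T)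
  ; sound    = λ i → let x∈ , y∈ = ∈-cartesianProduct⁻ S.elements T.elements i
                     in S.sound x∈ , T.sound y∈
  }
  where
  module S = FinSet S
  module T = FinSet T

module _ {A C : Set} {X : FinSet A} {Y : FinSet C} (R : Relation X Y) where

  graph : FinSet (A × C)
  graph = separate (X ×-finSet Y) {P = uncurry (rel R)}
    (λ (x , y) → rel? R x y) (within R)

  -- Splits each vertex into one copy per `R`-image. The conjunct `rel R x′ y` keeps the pair inside
  -- `graph`, since the ambient type is all of `A × C`.
  duplication : Relation (dom R) graph
  duplication = record
    { rel    = λ x (x′ , y) → x ≡ x′ × rel R x′ y
    ; rel?   = rel?′
    ; within = λ { (refl , r) → (_ , r) , r }
    }
    where
    rel?′ : ∀ x ((x′ , y) : A × C) → Dec (x ≡ x′ × rel R x′ y)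
    -- `R` is tested before equality: a positive answer supplies the membership of `x′` that
    -- `≡-member?` demands.
    rel?′ x (x′ , y) with rel? R x′ y
    ... | no ¬r = no (¬r ∘ proj₂)
    ... | yes r with ≡-member? X x (proj₁ (within R r))
    ...   | yes x≡x′ = yes (x≡x′ , r)
    ...   | no  x≢x′ = no (x≢x′ ∘ proj₁)

  contraction : Relation graph (img R)
  contraction = record
    { rel    = λ (x , y) y′ → y′ ≡ y × rel R x y
    ; rel?   = rel?′
    ; within = λ { (refl , r) → r , (_ , r) }
    }
    where
    rel?′ : ∀ ((x , y) : A × C) y′ → Dec (y′ ≡ y × rel R x y)
    rel?′ (x , y) y′ with rel? R x y
    ... | no ¬r = no (¬r ∘ proj₂)
    ... | yes r with ≡-member? Y y′ (proj₂ (within R r))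
    ...   | yes y′≡y = yes (y′≡y , r)
    ...   | no  y′≢y = no (y′≢y ∘ proj₁)

  duplication-injective : Injective duplication
  duplication-injective (p , _) (q , _) = trans p (sym q)

  duplication-fullDomain : FullDomain duplication
  duplication-fullDomain =
    (λ { (_ , refl , r) → _ , r }) , (λ (_ , r) → _ , refl , r)

  duplication-fullImage : FullImage duplication
  duplication-fullImage = (λ (_ , _ , r) → r) , (λ r → _ , refl , r)

  contraction-functional : Functional contraction
  contraction-functional (p , _) (q , _) = trans p (sym q)

  contraction-fullImage : FullImage contraction
  contraction-fullImage =
    (λ { (_ , refl , r) → _ , r }) , (λ (_ , r) → _ , refl , r)

corollary4p1p3 : {A C : Set} (G : Graph A) (H : Graph C)
    (R : Relation (V G) (V H)) (full : FullImage R) →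
    G ∗ R ⟨ full ⟩ ≈ H →
    Σ[ X ∈ Set ] Σ[ B ∈ FinSet X ]
    Σ[ R-D ∈ Relation (dom R) B ] Σ[ R-C ∈ Relation B (img R) ]
    Injective R-D × FullDomain R-D × Functional R-C ×
    (Σ[ full-D ∈ FullImage R-D ] Σ[ full-C ∈ FullImage R-C ]
    ((G [ dom R ∣ Dom⊆ R ]) ∗ R-D ⟨ full-D ⟩) ∗ R-C ⟨ full-C ⟩ ≈ H)
corollary4p1p3 G H R full (_ , G∗R⇒H , H⇒G∗R) =
  _ , graph R , duplication R , contraction R ,
  duplication-injective R , duplication-fullDomain R ,
  contraction-functional R ,
  duplication-fullImage R , contraction-fullImage R ,
  -- The final vertex set is `img R`, so equality of vertex sets is precisely fullness of `R`.
  full ,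
  (λ { (_ , _ , (u , v , (e , _) , (refl , _) , (refl , _)) ,
        (refl , r) , (refl , s)) → G∗R⇒H (u , v , e , r , s) }) ,
  -- The intermediate vertices are the copies `(u , a)` and `(v , b)` for the given edge `(a , b)`
  -- of `H`; `r` and `s` also witness that `u` and `v` lie in `dom R`.
  (λ h → let u , v , e , r , s = H⇒G∗R h in
    _ , _ , (u , v , (e , (_ , r) , (_ , s)) , (refl , r) , (refl , s)) ,
    (refl , r) , (refl , s))
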